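{- Let $(G_n)_{n\ge 0}$ be the sequence of graphs defined in the context, and let $T_n(x,y)=T(G_n;x,y)$ be the Tutte polynomial of $G_n$. For every positive integer $n\ge 1$, the Tutte polynomial of $G_n$ along the line $y=x$ is given by $$T_n(x,x)=x\,(x^2+5x+2)^{\frac{4^n-1}{3}}.$$
   Context: Tutte polynomial: for a graph $G$ with vertex set $V(G)$, edge set $E(G)$ and $k(G)$ connected components, put $r(G)=|V(G)|-k(G)$ and $n(G)=|E(G)|-|V(G)|+k(G)$. Then $T(G;x,y)=\sum_{H\subseteq G}(x-1)^{r(G)-r(H)}(y-1)^{n(H)}$, where the sum runs over all spanning subgraphs $H$ of $G$ (subgraphs with $V(H)=V(G)$ and arbitrary $E(H)\subseteq E(G)$). The graphs $G_n$: $G_0$ is the complete graph $K_2$ with its two vertices denoted $X_0,Y_0$. For $n\ge 0$, given $G_n$ with two special vertices $X_n,Y_n$, take four disjoint copies $G_n^1,G_n^2,G_n^3,G_n^4$ of $G_n$, with special vertices $X_n^i,Y_n^i$. Identify $X_n^1$ with $X_n^2$ to form the special vertex $X_{n+1}$ of $G_{n+1}$; identify $Y_n^3$ with $Y_n^4$ to form the special vertex $Y_{n+1}$ of $G_{n+1}$; identify $Y_n^1$ with $X_n^3$ to form a vertex $a$, and $Y_n^2$ with $X_n^4$ to form a vertex $b$; finally add a new edge $e_n$ joining $a$ and $b$. The result is $G_{n+1}$. -}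

module Defs where

open import Algebra.Bundles using (CommutativeRing)
import Algebra.Properties.Semiring.Exp as Exponentiation
open import Data.Fin using (Fin; zero; suc; _≟_; _↑ʳ_; combine; remQuot)
open import Data.Fin.Patterns using (0F; 1F; 2F; 3F)
open import Data.Fin.Properties using (remQuot-combine; combine-remQuot)
open import Data.List using (List; []; _∷_; _++_; [_]; map; concatMap; foldr; length; deduplicate; allFin)
open import Data.List.Membership.Propositional using (_∈_)
open import Data.List.Relation.Unary.Any using (here; there)
open import Data.Nat using (ℕ; zero; suc; _+_; _*_; _∸_)
open import Data.Product as Product using (_×_; _,_; uncurry; ∃)
open import Data.Sum as Sum using (_⊎_; inj₁; inj₂)
open import Function.Bundles using (_⇔_; mk⇔)
open import Level using (Level; 0ℓ)
open import Relation.Binary.Construct.Closure.Equivalence as Eq using (EqClosure)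
open import Relation.Binary.Construct.Closure.ReflexiveTransitive using (ε; _◅_; _◅◅_)
open import Relation.Binary.Construct.Closure.Symmetric using (fwd; bwd)
open import Relation.Binary.Core using (Rel)
open import Relation.Binary.Definitions using (Decidable)
open import Relation.Binary.PropositionalEquality using (_≡_; refl; sym; cong; subst; isEquivalence)
open import Relation.Nullary.Decidable using (map′; _⊎-dec_; _×-dec_)

private
  variable
    m : ℕ

-- Finite undirected graphs.  An edge is recorded by its two ends in an
-- arbitrary order; its identity is its position in the list, so loops and
-- parallel edges are allowed.
record Graph : Set where
  constructor graph
  field
    order : ℕ
    edges : List (Fin order × Fin order)

  size : ℕ
  size = length edges

open Graph

Connected : List (Fin m × Fin m) → Rel (Fin m) 0ℓ
Connected es = EqClosure (λ u v → (u , v) ∈ es)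

private
  Split : Fin m × Fin m → List (Fin m × Fin m) → Rel (Fin m) 0ℓ
  Split (s , t) es u v =
      Connected es u v
    ⊎ (Connected es u s × Connected es t v)
    ⊎ (Connected es u t × Connected es s v)

  unsplit : ∀ {s t : Fin m} {es u v} → Split (s , t) es u v → Connected ((s , t) ∷ es) u v
  unsplit (inj₁ p)              = Eq.map there p
  unsplit (inj₂ (inj₁ (p , q))) = Eq.map there p ◅◅ fwd (here refl) ◅ Eq.map there q
  unsplit (inj₂ (inj₂ (p , q))) = Eq.map there p ◅◅ bwd (here refl) ◅ Eq.map there q

  split : ∀ {s t : Fin m} {es u v} → Connected ((s , t) ∷ es) u v → Split (s , t) es u v
  split ε = inj₁ ε
  split (fwd (there e) ◅ p) =
    Sum.map (fwd e ◅_) (Sum.map (Product.map₁ (fwd e ◅_)) (Product.map₁ (fwd e ◅_))) (split p)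
  split (bwd (there e) ◅ p) =
    Sum.map (bwd e ◅_) (Sum.map (Product.map₁ (bwd e ◅_)) (Product.map₁ (bwd e ◅_))) (split p)
  split (fwd (here refl) ◅ p) with split p
  ... | inj₁ q              = inj₂ (inj₁ (ε , q))
  ... | inj₂ (inj₁ (_ , q)) = inj₂ (inj₁ (ε , q))
  ... | inj₂ (inj₂ (_ , q)) = inj₁ q
  split (bwd (here refl) ◅ p) with split p
  ... | inj₁ q              = inj₂ (inj₂ (ε , q))
  ... | inj₂ (inj₁ (_ , q)) = inj₁ q
  ... | inj₂ (inj₂ (_ , q)) = inj₂ (inj₂ (ε , q))

connected? : (es : List (Fin m × Fin m)) → Decidable (Connected es)
connected? [] u v = map′ (λ { refl → ε }) (Eq.fold isEquivalence λ ()) (u ≟ v)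
connected? ((s , t) ∷ es) u v = map′ unsplit split
  (connected? es u v
    ⊎-dec (connected? es u s ×-dec connected? es t v)
    ⊎-dec (connected? es u t ×-dec connected? es s v))

-- The number of connected components: the vertices are listed keeping only
-- the first one of each connectedness class.
components : Graph → ℕ
components H = length (deduplicate (connected? (edges H)) (allFin (order H)))

-- No truncation takes place in the subtractions below: a graph satisfies
-- components ≤ order ≤ size + components, and a spanning subgraph has rank
-- at most that of the whole graph.
rank : Graph → ℕ
rank H = order H ∸ components H

nullity : Graph → ℕ
nullity H = (size H + components H) ∸ order H

-- One sublist for each set of positions, so repeated entries are treated as
-- distinct: 2 ^ length xs sublists in total.
sublists : ∀ {a} {A : Set a} → List A → List (List A)
sublists []       = [ [] ]
sublists (x ∷ xs) = sublists xs ++ map (x ∷_) (sublists xs)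

spanningSubgraphs : Graph → List Graph
spanningSubgraphs (graph v es) = map (graph v) (sublists es)

-- Value of the Tutte polynomial at a point of an arbitrary commutative ring.
-- The case R = ℤ[x,y] with the two indeterminates is the polynomial itself.
module _ {c ℓ : Level} (R : CommutativeRing c ℓ) where
  private
    module R = CommutativeRing R
    open Exponentiation R.semiring using (_^_)

  tutte : Graph → R.Carrier → R.Carrier → R.Carrier
  tutte H x y = foldr R._+_ R.0# (map term (spanningSubgraphs H))
    where
    term : Graph → R.Carrier
    term K = ((x R.- R.1#) ^ (rank H ∸ rank K)) R.* ((y R.- R.1#) ^ nullity K)

-- The vertices of G n are numbered so that 0 and 1 are the special vertices
-- X and Y; for n > 0, 2 and 3 are the vertices a and b, and the remaining
-- ones are the non-special vertices of the four copies of G (n - 1).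
pattern X = zero
pattern Y = suc zero
pattern a = suc (suc zero)
pattern b = suc (suc (suc zero))

nonSpecial : ℕ → ℕ
nonSpecial zero    = 0
nonSpecial (suc n) = 2 + 4 * nonSpecial n

-- copy i sends a vertex of the (i + 1)-st copy to its image after the
-- identifications.
copy : Fin 4 → Fin (2 + m) → Fin (4 + 4 * m)
copy i  (suc (suc w)) = 4 ↑ʳ combine i w
copy 0F X = X
copy 0F Y = a
copy 1F X = X
copy 1F Y = b
copy 2F X = a
copy 2F Y = Y
copy 3F X = b
copy 3F Y = Y

G-edges : ∀ n → List (Fin (2 + nonSpecial n) × Fin (2 + nonSpecial n))
G-edges zero    = [ (X , Y) ]
G-edges (suc n) = (a , b) ∷ concatMap (λ i → map (Product.map (copy i) (copy i)) (G-edges n)) (allFin 4)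

G : ℕ → Graph
G n = graph (2 + nonSpecial n) (G-edges n)

-- The maps copy i do present Fin (4 + 4 * m) as the disjoint union of four
-- copies of Fin (2 + m) modulo exactly the following identifications.
data Identified {m : ℕ} : Rel (Fin 4 × Fin (2 + m)) 0ℓ where
  X¹X² : Identified (0F , X) (1F , X)
  Y³Y⁴ : Identified (2F , Y) (3F , Y)
  Y¹X³ : Identified (0F , Y) (2F , X)
  Y²X⁴ : Identified (1F , Y) (3F , X)

private
  representative : Fin (4 + 4 * m) → Fin 4 × Fin (2 + m)
  representative X = 0F , X
  representative Y = 2F , Y
  representative a = 0F , Y
  representative b = 1F , Y
  representative {m} (suc (suc (suc (suc k)))) = Product.map₂ (2 ↑ʳ_) (remQuot m k)

  to-representative : (p : Fin 4 × Fin (2 + m)) → EqClosure Identified p (representative (uncurry copy p))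
  to-representative {m} (i , suc (suc w)) =
    subst (λ q → EqClosure Identified (i , suc (suc w)) (Product.map₂ (2 ↑ʳ_) q)) (sym (remQuot-combine {k = m} i w)) ε
  to-representative (0F , X) = ε
  to-representative (0F , Y) = ε
  to-representative (1F , X) = bwd X¹X² ◅ ε
  to-representative (1F , Y) = ε
  to-representative (2F , X) = bwd Y¹X³ ◅ ε
  to-representative (2F , Y) = ε
  to-representative (3F , X) = bwd Y²X⁴ ◅ ε
  to-representative (3F , Y) = bwd Y³Y⁴ ◅ ε

  copy-identifies : {p q : Fin 4 × Fin (2 + m)} → Identified p q → uncurry copy p ≡ uncurry copy q
  copy-identifies X¹X² = refl
  copy-identifies Y³Y⁴ = refl
  copy-identifies Y¹X³ = refl
  copy-identifies Y²X⁴ = refl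

copy-kernel : {p q : Fin 4 × Fin (2 + m)} →
              EqClosure Identified p q ⇔ uncurry copy p ≡ uncurry copy q
copy-kernel {p = p} {q} = mk⇔
  (Eq.gfold isEquivalence (uncurry copy) copy-identifies)
  (λ e → to-representative p ◅◅
         Eq.symmetric Identified
           (subst (λ k → EqClosure Identified q (representative k)) (sym e) (to-representative q)))

copy-surjective : (v : Fin (4 + 4 * m)) → ∃ λ (p : Fin 4 × Fin (2 + m)) → uncurry copy p ≡ v
copy-surjective X = (0F , X) , refl
copy-surjective Y = (2F , Y) , refl
copy-surjective a = (0F , Y) , refl
copy-surjective b = (1F , Y) , refl
copy-surjective {m} (suc (suc (suc (suc k)))) =
  Product.map₂ (2 ↑ʳ_) (remQuot m k) , cong (4 ↑ʳ_) (combine-remQuot {4} m k)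

{-# OPTIONS --safe #-}
module Submission where

-- Along y = x, put z = x − 1.  Among the spanning subgraphs H of a graph with
-- terminals X and Y, separate those joining X to Y, with weight z ^ (r(G) − r(H) + n(H)),
-- from those that do not, with weight z ^ (r(G) − r(H) − 1 + n(H)).  The two
-- total weights of Gₙ agree: the bridge network (a square with one diagonal)
-- that builds Gₙ₊₁ from Gₙ is self-dual, and for z = x − 1 = y − 1 duality exchanges the
-- two sums.  If A is the common value for Gₙ, every one of the 32 states of the bridge
-- gets weight A⁴ times a power of z, and either half of them sums to
-- A⁴ (z² + 7z + 8) = A⁴ (x² + 5x + 2).  Finally Tₙ = A + z A = x A.

open import Algebra.Bundles using (CommutativeRing)
open import Algebra.Properties.Semiring.Exp as Exponentiation using ()
open import Algebra.Properties.Semiring.Mult as Multiples using ()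
import Algebra.Solver.Ring.NaturalCoefficients.Default as RingSolver
open import Data.Bool using (Bool; true; false; not; _∧_; _∨_; if_then_else_)
open import Data.Fin using (Fin; zero; suc)
open import Data.List using (List; []; _∷_; [_]; _++_; map; foldr; length; filter; deduplicate; allFin)
open import Data.List.Membership.Propositional using (_∈_)
open import Data.List.Relation.Binary.Sublist.Propositional using (_⊆_; []; _∷_; _∷ʳ_; ⊆-refl; lookup)
open import Data.List.Relation.Unary.Any as Any using (any?; here; there)
open import Data.Nat as ℕ using (ℕ; zero; suc; _∸_)
open import Data.Nat.DivMod using (_/_; m*n/n≡m)
open import Data.Nat.Solver using (module +-*-Solver)
open import Data.Product as Product using (_,_; proj₁; proj₂)
open import Data.Vec as Vec using (Vec; []; _∷_; replicate)
open import Data.Vec.Relation.Unary.All as VecAll using ([]; _∷_)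
open import Defs using (G; tutte)
open import Defs using (graph; components; rank; nullity; Connected; connected?; sublists; nonSpecial; copy; G-edges; X; Y; a; b)
open import Function using (_∘_; id)
open import Relation.Binary.PropositionalEquality as ≡ using (_≡_)

module BridgeNetwork where
  open import Data.Bool.Properties using (∨-identityʳ)
  open import Data.Fin using (_≟_; _↑ʳ_)
  open import Data.Fin.Patterns using (0F; 1F; 2F; 3F)
  open import Data.Fin.Properties using (↑ʳ-injective; combine-injectiveˡ; combine-injectiveʳ)
  open import Data.List.Membership.Propositional.Properties using (∈-allFin; ∈-map⁻; ∈-++⁻)
  open import Data.List.Properties using (filter-all; length-++; length-map; length-tabulate; ++-assoc)
  open import Data.List.Relation.Binary.Permutation.Propositional using (_↭_; ↭-sym)
  open import Data.List.Relation.Binary.Permutation.Propositional.Properties using (∈-resp-↭; shifts; ++-comm)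
  open import Data.List.Relation.Binary.Sublist.Propositional.Properties using (++⁺)
  open import Data.List.Relation.Unary.All as All using (All; []; _∷_)
  import Data.List.Relation.Unary.All.Properties as All
  open import Data.List.Relation.Unary.AllPairs as AllPairs using (AllPairs; []; _∷_)
  import Data.List.Relation.Unary.Any.Properties as Any
  open import Data.List.Relation.Unary.Unique.DecSetoid.Properties using (deduplicate-!)
  open import Data.List.Relation.Unary.Unique.Propositional.Properties using (allFin⁺)
  open import Data.Nat using (_+_; _*_; _≤_; z≤n; s≤s)
  open import Data.Nat.Properties hiding (_≟_)
  open import Data.Product using (_×_)
  open import Data.Sum using (inj₁; inj₂)
  open import Data.Vec.Relation.Unary.AllPairs as VecPairs using ([]; _∷_)
  open import Function.Bundles using (mk⇔)
  open import Level using (0ℓ)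
  open import Relation.Binary.Construct.Closure.Equivalence as Eq using ()
  open import Relation.Binary.Construct.Closure.ReflexiveTransitive using (ε; _◅_)
  open import Relation.Binary.Construct.Closure.Symmetric using (bwd)
  open import Relation.Binary.Bundles using (DecSetoid)
  open import Relation.Binary.Core using (Rel)
  open import Relation.Binary.Definitions using (Decidable)
  open import Relation.Binary.PropositionalEquality using (_≢_; refl; sym; trans; cong; cong₂; module ≡-Reasoning)
  open import Relation.Binary.Structures using (IsEquivalence)
  open import Relation.Nullary using (¬_; Dec; yes; no; does; invert; _because_)
  open import Relation.Nullary.Decidable using (dec-true; dec-false; does-⇔; ¬?)
  open +-*-Solver using (solve; _:=_; _:+_; con)

  private
    variable
      m k : ℕ

  Edges : ℕ → Set
  Edges m = List (Fin m × Fin m)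

  ⟦_⟧ : Bool → ℕ
  ⟦ true ⟧  = 1
  ⟦ false ⟧ = 0

  -- Classes of a decidable equivalence met by a list

  module _ {A : Set} {R : Rel A 0ℓ} (isEq : IsEquivalence R) (R? : Decidable R) where
    private
      module R = IsEquivalence isEq

    occurs : A → List A → Bool
    occurs x xs = does (any? (R? x) xs)

    occurs-cong : ∀ {x y} → R x y → ∀ xs → occurs x xs ≡ occurs y xs
    occurs-cong r xs = does-⇔ 
      (mk⇔ (Any.map (R.trans (R.sym r))) (Any.map (R.trans r))) (any? (R? _) xs) (any? (R? _) xs)

    -- Among pairwise inequivalent entries at most one is equivalent to `x`, by transitivity, so the
    -- filter drops one entry or none.
    length-reject : ∀ x {ys} → AllPairs (λ y z → ¬ R y z) ys →
                    ⟦ occurs x ys ⟧ + length (filter (¬? ∘ R? x) ys) ≡ length ys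
    length-reject x [] = refl
    length-reject x {y ∷ ys} (¬rs ∷ u) with R? x y
    ... | true because [r] =
          cong (suc ∘ length) (filter-all (¬? ∘ R? x) (All.map (λ ¬s t → ¬s (R.trans (R.sym (invert [r])) t)) ¬rs))
    ... | false because _ = trans (+-suc _ _) (cong suc (length-reject x u))

    classes : List A → ℕ
    classes xs = length (deduplicate R? xs)

    -- `deduplicate` keeps `x` and strikes its equivalents from the deduplicated tail, which has at
    -- most one by `length-reject`. Whether a class is met does not change under deduplication.
    classes-∷ : ∀ x xs → classes (x ∷ xs) ≡ ⟦ not (occurs x xs) ⟧ + classes xs
    classes-∷ x xs with occurs x xs | occurs-deduplicate | length-reject x (deduplicate-! decSetoid xs)
      where
      decSetoid : DecSetoid 0ℓ 0ℓ
      decSetoid = record { isDecEquivalence = record { isEquivalence = isEq ; _≟_ = R? } }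
      occurs-deduplicate : occurs x (deduplicate R? xs) ≡ occurs x xs
      occurs-deduplicate = does-⇔
        (mk⇔ (Any.deduplicate⁻ R?) (Any.deduplicate⁺ R? (λ s r → R.trans r (R.sym s))))
        (any? (R? x) (deduplicate R? xs)) (any? (R? x) xs)
    ... | true  | e | p rewrite e = p
    ... | false | e | p rewrite e = cong suc p

    classes-separated : ∀ {xs} → AllPairs (λ y z → ¬ R y z) xs → classes xs ≡ length xs
    classes-separated [] = refl
    classes-separated {x ∷ xs} (¬rs ∷ u) = begin
      classes (x ∷ xs)                    ≡⟨ classes-∷ x xs ⟩
      ⟦ not (occurs x xs) ⟧ + classes xs
        ≡⟨ cong (λ o → ⟦ not o ⟧ + classes xs) (dec-false (any? (R? x) xs) (All.All¬⇒¬Any ¬rs)) ⟩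
      suc (classes xs)                    ≡⟨ cong suc (classes-separated u) ⟩
      suc (length xs)                     ∎
      where open ≡-Reasoning

  -- By `classes-∷` an entry adds a class when it is equivalent to no later entry, and this is
  -- harder to achieve for the coarser relation `S`.
  classes-antitone : ∀ {A : Set} {R S : Rel A 0ℓ} (isEqR : IsEquivalence R) (isEqS : IsEquivalence S)
                     (R? : Decidable R) (S? : Decidable S) → (∀ {x y} → R x y → S x y) →
                     ∀ xs → classes isEqS S? xs ≤ classes isEqR R? xs
  classes-antitone eR eS R? S? R⇒S [] = z≤n
  classes-antitone eR eS R? S? R⇒S (x ∷ xs)
    rewrite classes-∷ eR R? x xs | classes-∷ eS S? x xs =
    +-mono-≤ fresh (classes-antitone eR eS R? S? R⇒S xs)
    where
    fresh : ⟦ not (occurs eS S? x xs) ⟧ ≤ ⟦ not (occurs eR R? x xs) ⟧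
    fresh with any? (R? x) xs
    ... | false because _ = ⟦⟧≤1 (not (occurs eS S? x xs))
      where
      ⟦⟧≤1 : ∀ c → ⟦ c ⟧ ≤ 1
      ⟦⟧≤1 true = s≤s z≤n
      ⟦⟧≤1 false = z≤n
    ... | yes r rewrite dec-true (any? (S? x) xs) (Any.map R⇒S r) = z≤n

  -- Rank of an edge list and connected components

  conn : Edges m → Fin m → Fin m → Bool
  conn es u v = does (connected? es u v)

  -- The size of the spanning forest grown greedily from the end of the list. Unlike `rank`, it
  -- follows the list structure, so it suits induction and evaluates on explicit edges.
  rk : Edges m → ℕ
  rk []             = 0
  rk ((s , t) ∷ es) = ⟦ not (conn es s t) ⟧ + rk es

  isEq : (es : Edges m) → IsEquivalence (Connected es)
  isEq es = Eq.isEquivalence (λ u v → (u , v) ∈ es)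

  module _ (es : Edges m) where
    open IsEquivalence (isEq es) public
      using () renaming (refl to C-refl; sym to C-sym; trans to C-trans)

  conn-congʳ : (es : Edges m) {u v : Fin m} → Connected es u v → ∀ w → conn es w u ≡ conn es w v
  conn-congʳ es p w = does-⇔
    (mk⇔ (λ q → C-trans es q p) (λ q → C-trans es q (C-sym es p)))
    (connected? es w _) (connected? es w _)

  conn-sym : (es : Edges m) (u v : Fin m) → conn es u v ≡ conn es v u
  conn-sym es u v = does-⇔ (mk⇔ (C-sym es) (C-sym es)) (connected? es u v) (connected? es v u)

  conn-refl : (es : Edges m) (u : Fin m) → conn es u u ≡ true
  conn-refl es u = dec-true (connected? es u u) (C-refl es)

  classesOf : Edges m → List (Fin m) → ℕ
  classesOf es = classes (isEq es) (connected? es)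

  module _ (s t : Fin m) (es : Edges m) where
    private
      es⁺ : Edges m
      es⁺ = (s , t) ∷ es

      occ : Fin m → List (Fin m) → Bool
      occ = occurs (isEq es) (connected? es)

      occ⁺ : Fin m → List (Fin m) → Bool
      occ⁺ = occurs (isEq es⁺) (connected? es⁺)

      occ⁺-end : ¬ Connected es s t → ∀ xs → occ⁺ s xs ≡ occ s xs ∨ occ t xs
      occ⁺-end ¬st [] = refl
      occ⁺-end ¬st (y ∷ ys)
        -- On the longer list `connected?` computes to a disjunction: avoid the new edge, use it
        -- forwards, or use it backwards. The rewrites settle the constituents that are known.
        rewrite occ⁺-end ¬st ys | dec-false (connected? es s t) ¬st | conn-refl es s
        with conn es s y | conn es t y | occ s ys
      ... | true  | _     | _     = refl
      ... | false | false | _     = refl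
      ... | false | true  | true  = refl
      ... | false | true  | false = refl

      occ⁺-else : ∀ x → ¬ Connected es x s → ¬ Connected es x t → ∀ xs → occ⁺ x xs ≡ occ x xs
      occ⁺-else x ¬p ¬q [] = refl
      occ⁺-else x ¬p ¬q (y ∷ ys)
        rewrite occ⁺-else x ¬p ¬q ys
              | dec-false (connected? es x s) ¬p | dec-false (connected? es x t) ¬q
              | ∨-identityʳ (conn es x y) = refl

    -- Fusing two classes lowers the count by one, but a list notices only if it meets both.
    -- Arbitrary lists are allowed so that induction can reach `allFin m`.
    classes-merge : ¬ Connected es s t → ∀ xs →
                    classesOf es xs ≡ ⟦ occ s xs ∧ occ t xs ⟧ + classesOf es⁺ xs
    classes-merge ¬st [] = refl
    classes-merge ¬st (x ∷ xs)
      rewrite classes-∷ (isEq es) (connected? es) x xs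
            | classes-∷ (isEq es⁺) (connected? es⁺) x xs
            | classes-merge ¬st xs = step (connected? es x s) (connected? es x t)
      where
      step : Dec (Connected es x s) → Dec (Connected es x t) →
             ⟦ not (occ x xs) ⟧ + (⟦ occ s xs ∧ occ t xs ⟧ + classesOf es⁺ xs) ≡
             ⟦ occ s (x ∷ xs) ∧ occ t (x ∷ xs) ⟧ + (⟦ not (occ⁺ x xs) ⟧ + classesOf es⁺ xs)
      -- Either `x` lies in the class of `s` or of `t`, and its new class is the fused one, or it
      -- lies in neither, and its presence affects neither end.
      step (yes p) _
        rewrite occurs-cong (isEq es⁺) (connected? es⁺) (Eq.map there p) xs | occ⁺-end ¬st xs
              | occurs-cong (isEq es) (connected? es) p xs
              | conn-congʳ es p s | conn-refl es s
              | conn-congʳ es p t | conn-sym es t s | dec-false (connected? es s t) ¬st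
        with occ s xs | occ t xs
      ... | true  | true  = refl
      ... | true  | false = refl
      ... | false | true  = refl
      ... | false | false = refl
      step (no ¬p) (yes q)
        rewrite occurs-cong (isEq es⁺) (connected? es⁺) (C-trans es⁺ (Eq.map there q) (bwd (here refl) ◅ ε)) xs
              | occ⁺-end ¬st xs
              | occurs-cong (isEq es) (connected? es) q xs
              | conn-congʳ es q s | dec-false (connected? es s t) ¬st
              | conn-congʳ es q t | conn-refl es t
        with occ s xs | occ t xs
      ... | true  | true  = refl
      ... | true  | false = refl
      ... | false | true  = refl
      ... | false | false = refl
      step (no ¬p) (no ¬q)
        rewrite occ⁺-else x ¬p ¬q xs
              | conn-sym es s x | dec-false (connected? es x s) ¬p
              | conn-sym es t x | dec-false (connected? es x t) ¬q
        with occ x xs | occ s xs | occ t xs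
      ... | true  | _     | _     = refl
      ... | false | true  | true  = refl
      ... | false | true  | false = refl
      ... | false | false | true  = refl
      ... | false | false | false = refl

  components-mono : {es fs : Edges m} → (∀ {u v} → Connected es u v → Connected fs u v) →
                    components (graph m fs) ≤ components (graph m es)
  components-mono {m} {es} {fs} h = classes-antitone (isEq es) (isEq fs) (connected? es) (connected? fs) h (allFin m)

  absorb : {s t : Fin m} {es : Edges m} → Connected es s t → ∀ {u v} → Connected ((s , t) ∷ es) u v → Connected es u v
  absorb {es = es} p = Eq.fold (isEq es) λ { (here refl) → p ; (there e) → Eq.return e }

  -- An edge within a component creates no new connection; an edge between two components fuses
  -- them, and the list of all vertices meets both.
  components-∷ : ∀ (s t : Fin m) es →
    components (graph m es) ≡ ⟦ not (conn es s t) ⟧ + components (graph m ((s , t) ∷ es))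
  components-∷ {m} s t es with connected? es s t
  ... | yes p = ≤-antisym (components-mono {es = (s , t) ∷ es} (absorb p)) (components-mono {es = es} (Eq.map there))
  ... | no ¬p = trans (classes-merge s t es ¬p (allFin m)) (cong (λ c → ⟦ c ⟧ + components (graph m ((s , t) ∷ es))) both)
    where
    occursAll : ∀ u → occurs (isEq es) (connected? es) u (allFin m) ≡ true
    occursAll u = dec-true (any? (connected? es u) (allFin m)) (Any.map (λ { refl → ε }) (∈-allFin u))
    both : occurs (isEq es) (connected? es) s (allFin m) ∧ occurs (isEq es) (connected? es) t (allFin m) ≡ true
    both rewrite occursAll s | occursAll t = refl

  -- Without edges each vertex is a component of its own. By `components-∷`, each edge that `rk`
  -- counts then removes one component and the others remove none.
  rk+components : (es : Edges m) → rk es + components (graph m es) ≡ m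
  rk+components {m} [] = trans
    (classes-separated (isEq []) (connected? [])
      (AllPairs.map (λ u≢v p → u≢v (Eq.fold ≡.isEquivalence (λ ()) p)) (allFin⁺ m)))
    (length-tabulate id)
  rk+components {m} ((s , t) ∷ es) = begin
    ⟦ not (conn es s t) ⟧ + rk es + components (graph m ((s , t) ∷ es))    ≡⟨ +-assoc ⟦ not (conn es s t) ⟧ _ _ ⟩
    ⟦ not (conn es s t) ⟧ + (rk es + components (graph m ((s , t) ∷ es)))
      ≡⟨ cong (⟦ not (conn es s t) ⟧ +_) (+-comm (rk es) _) ⟩
    ⟦ not (conn es s t) ⟧ + (components (graph m ((s , t) ∷ es)) + rk es)  ≡⟨ +-assoc ⟦ not (conn es s t) ⟧ _ _ ⟨
    ⟦ not (conn es s t) ⟧ + components (graph m ((s , t) ∷ es)) + rk es    ≡⟨ cong (_+ rk es) (components-∷ s t es) ⟨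
    components (graph m es) + rk es                                        ≡⟨ +-comm _ (rk es) ⟩
    rk es + components (graph m es)                                        ≡⟨ rk+components es ⟩
    m                                                                      ∎
    where open ≡-Reasoning

  rank≡rk : (es : Edges m) → rank (graph m es) ≡ rk es
  rank≡rk {m} es = trans
    (cong (_∸ components (graph m es)) (sym (rk+components es)))
    (m+n∸n≡m (rk es) (components (graph m es)))

  nullity≡ : (es : Edges m) → nullity (graph m es) ≡ length es ∸ rk es
  nullity≡ {m} es = trans
    (cong ((length es + components (graph m es)) ∸_) (sym (rk+components es)))
    ([m+n]∸[o+n]≡m∸o (length es) (components (graph m es)) (rk es))
    where
    [m+n]∸[o+n]≡m∸o : ∀ m n o → (m + n) ∸ (o + n) ≡ m ∸ o
    [m+n]∸[o+n]≡m∸o m n o rewrite +-comm m n | +-comm o n = [m+n]∸[m+o]≡n∸o n m o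

  rk-mono : {es fs : Edges m} → (∀ {e} → e ∈ es → e ∈ fs) → rk es ≤ rk fs
  rk-mono {m} {es} {fs} es⊆fs = +-cancelʳ-≤ _ (rk es) (rk fs) (begin
    rk es + components (graph m fs)  ≤⟨ +-monoʳ-≤ (rk es) (components-mono {es = es} (Eq.map es⊆fs)) ⟩
    rk es + components (graph m es)  ≡⟨ trans (rk+components es) (sym (rk+components fs)) ⟩
    rk fs + components (graph m fs)  ∎)
    where open ≤-Reasoning

  -- The recursion of `rk` depends on the order of edges, its value only on which edges occur. This
  -- permits moving edges to the front, where the recursion reaches them.
  rk-↭ : {es fs : Edges m} → es ↭ fs → rk es ≡ rk fs
  rk-↭ p = ≤-antisym (rk-mono (∈-resp-↭ p)) (rk-mono (∈-resp-↭ (↭-sym p)))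

  rk≤length : (es : Edges m) → rk es ≤ length es
  rk≤length [] = z≤n
  rk≤length ((s , t) ∷ es) with conn es s t
  ... | true  = m≤n⇒m≤1+n (rk≤length es)
  ... | false = s≤s (rk≤length es)

  -- Trading copies of a graph for single edges

  link : Bool → Fin m → Fin m → Edges m
  link true  u v = [ (u , v) ]
  link false u v = []

  image : (Fin m → Fin k) → Edges m → Edges k
  image c = map (Product.map c c)

  sum : (Edges m → ℕ) → Vec (Edges m) k → ℕ
  sum f Hs = Vec.sum (Vec.map f Hs)

  joined : Edges (2 + m) → Bool
  joined H = conn H X Y

  module Copies (m : ℕ) where

    glue : Fin 4 → Fin (2 + m) → Fin (4 + 4 * m)
    glue = copy

    Interior≢ : Fin 4 → Fin (4 + 4 * m) → Set
    Interior≢ j p = (w : Fin m) → glue j (suc (suc w)) ≢ p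

    Avoids : Fin 4 → Edges (4 + 4 * m) → Set
    Avoids j = All (λ (p , q) → Interior≢ j p × Interior≢ j q)

    interior≢X : ∀ j i → Interior≢ j (glue i X)
    interior≢X j 0F w ()
    interior≢X j 1F w ()
    interior≢X j 2F w ()
    interior≢X j 3F w ()

    interior≢Y : ∀ j i → Interior≢ j (glue i Y)
    interior≢Y j 0F w ()
    interior≢Y j 1F w ()
    interior≢Y j 2F w ()
    interior≢Y j 3F w ()

    module _ (j : Fin 4) (K : Edges (4 + 4 * m)) (avoids : Avoids j K) where
      private
        c : Fin (2 + m) → Fin (4 + 4 * m)
        c = glue j

        -- All that copy `j` can detect of `K`: whether `K` connects its two terminals.
        J : Edges (2 + m)
        J = link (conn K (c X) (c Y)) X Y

        isolated : ∀ {K} → Avoids j K → ∀ w p → conn K (c (suc (suc w))) p ≡ does (c (suc (suc w)) ≟ p)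
        isolated [] w p = refl
        isolated {(s , t) ∷ K} (av ∷ avs) w p
          rewrite isolated avs w p | isolated avs w s | isolated avs w t
                | dec-false (c (suc (suc w)) ≟ s) (proj₁ av w) | dec-false (c (suc (suc w)) ≟ t) (proj₂ av w)
                = ∨-identityʳ _

        does-interior : ∀ w v → does (c (suc (suc w)) ≟ c v) ≡ does (suc (suc w) ≟ v)
        does-interior w X = dec-false (c (suc (suc w)) ≟ c X) (interior≢X j j w)
        does-interior w Y = dec-false (c (suc (suc w)) ≟ c Y) (interior≢Y j j w)
        does-interior w (suc (suc w′)) = does-⇔
          (mk⇔ (λ e → cong (2 ↑ʳ_) (combine-injectiveʳ j w j w′ (↑ʳ-injective 4 _ _ e))) (cong c))
          (c (suc (suc w)) ≟ c (suc (suc w′))) (suc (suc w) ≟ suc (suc w′))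

        conn-interior : ∀ w v → conn K (c (suc (suc w))) (c v) ≡ conn J (suc (suc w)) v
        conn-interior w v with conn K (c X) (c Y)
        ... | true  = trans (isolated avoids w (c v)) (trans (does-interior w v) (sym (∨-identityʳ _)))
        ... | false = trans (isolated avoids w (c v)) (does-interior w v)

        conn-ends : conn K (c X) (c Y) ≡ conn J X Y
        conn-ends with conn K (c X) (c Y)
        ... | true  = refl
        ... | false = refl

        -- Interior vertices are isolated in both `K` and `J`, and `J` has its edge exactly when `K`
        -- connects the terminals.
        conn-outside : ∀ u v → conn K (c u) (c v) ≡ conn J u v
        conn-outside (suc (suc w)) v = conn-interior w v
        conn-outside u (suc (suc w)) = trans (conn-sym K (c u) _) (trans (conn-interior w u) (conn-sym J _ u))
        conn-outside X X = trans (conn-refl K (c X)) (sym (conn-refl J X))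
        conn-outside X Y = conn-ends
        conn-outside Y X = trans (conn-sym K (c Y) (c X)) (trans conn-ends (conn-sym J X Y))
        conn-outside Y Y = trans (conn-refl K (c Y)) (sym (conn-refl J Y))

        -- Both sides obey the recursion of `connected?` along `H`, so the agreement for empty `H`,
        -- given by `conn-outside`, propagates.
        conn-image : ∀ H u v → conn (image c H ++ K) (c u) (c v) ≡ conn (H ++ J) u v
        conn-image [] u v = conn-outside u v
        conn-image ((s , t) ∷ H) u v
          rewrite conn-image H u v | conn-image H u s | conn-image H t v
                | conn-image H u t | conn-image H s v = refl

        -- By `conn-image` an edge of `H` counts on top of `K` exactly when it counts on top of `J`.
        -- The two surpluses agree, expressed here without subtraction.
        rk-image : ∀ H → rk (image c H ++ K) + rk J ≡ rk (H ++ J) + rk K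
        rk-image [] = +-comm (rk K) (rk J)
        rk-image ((s , t) ∷ H) rewrite conn-image H s t =
          trans (+-assoc ⟦ not (conn (H ++ J) s t) ⟧ _ _)
            (trans (cong (⟦ not (conn (H ++ J) s t) ⟧ +_) (rk-image H))
              (sym (+-assoc ⟦ not (conn (H ++ J) s t) ⟧ _ _)))

      -- K sees a copy of H only through its terminals, so the copy may be
      -- traded for one edge between them, or none, according to joined H.
      rk-replace : ∀ H → rk (image c H ++ K) + ⟦ joined H ⟧ ≡ rk H + rk (link (joined H) (c X) (c Y) ++ K)
      -- With `J` in front, `rk` unfolds over its at most one edge and exposes `joined H`.
      rk-replace H with rk-image H | rk-↭ (++-comm H J)
      ... | p | q with joined H in eqH | conn K (c X) (c Y) in eqK
      ... | false | false = trans p (cong (_+ rk K) q)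
      ... | true  | false rewrite eqK =
            trans (cong (_+ 1) (trans (sym (+-identityʳ _)) (trans p (cong (_+ rk K) q))))
              (solve 2 (λ h κ → h :+ κ :+ con 1 := h :+ (con 1 :+ κ)) refl (rk H) (rk K))
      ... | false | true  rewrite eqH =
            trans (+-identityʳ _) (suc-injective (trans (sym (+-comm _ 1)) (trans p (cong (_+ rk K) q))))
      ... | true  | true  rewrite eqH | eqK = trans p (cong (_+ rk K) q)

    copies : Vec (Fin 4) k → Vec (Edges (2 + m)) k → Edges (4 + 4 * m)
    copies []       []       = []
    copies (j ∷ js) (H ∷ Hs) = image (glue j) H ++ copies js Hs

    skeleton : Vec (Fin 4) k → Vec Bool k → Edges (4 + 4 * m)
    skeleton []       []       = []
    skeleton (j ∷ js) (β ∷ βs) = link β (glue j X) (glue j Y) ++ skeleton js βs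

    link-avoids : ∀ β i j → Avoids j (link β (glue i X) (glue i Y))
    link-avoids true  i j = (interior≢X j i , interior≢Y j i) ∷ []
    link-avoids false i j = []

    image-avoids : ∀ {i j} → i ≢ j → ∀ H → Avoids j (image (glue i) H)
    image-avoids {i} {j} i≢j H = All.map⁺ (All.universal (λ (s , t) → avoid s , avoid t) H)
      where
      avoid : ∀ v → Interior≢ j (glue i v)
      avoid X = interior≢X j i
      avoid Y = interior≢Y j i
      avoid (suc (suc w′)) w e = i≢j (sym (combine-injectiveˡ j w i w′ (↑ʳ-injective 4 _ _ e)))

    copies-avoid : ∀ {j} {js : Vec (Fin 4) k} → VecAll.All (j ≢_) js → ∀ Hs → Avoids j (copies js Hs)
    copies-avoid [] [] = []
    copies-avoid (j≢i ∷ j≢is) (H ∷ Hs) = All.++⁺ (image-avoids (j≢i ∘ sym) H) (copies-avoid j≢is Hs)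

    -- The copies are replaced one at a time, and `K` accumulates the links already put in place.
    -- Distinctness of `js` keeps the remaining copies off the interior of the current one, as
    -- `rk-replace` demands.
    rk-copies : ∀ {js : Vec (Fin 4) k} → VecPairs.AllPairs _≢_ js → {K : Edges (4 + 4 * m)} → (∀ j → Avoids j K) →
                ∀ Hs → rk (K ++ copies js Hs) + sum (⟦_⟧ ∘ joined) Hs ≡
                       sum rk Hs + rk (K ++ skeleton js (Vec.map joined Hs))
    rk-copies [] av [] = +-comm _ 0
    rk-copies {js = j ∷ js} (j≢ ∷ js!) {K} av (H ∷ Hs) = begin
      rk (K ++ image (glue j) H ++ copies js Hs) + (⟦ β ⟧ + β⋆)
        ≡⟨ cong (_+ (⟦ β ⟧ + β⋆)) (rk-↭ (shifts K (image (glue j) H))) ⟩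
      rk (image (glue j) H ++ K ++ copies js Hs) + (⟦ β ⟧ + β⋆)
        ≡⟨ +-assoc (rk (image (glue j) H ++ K ++ copies js Hs)) _ _ ⟨
      rk (image (glue j) H ++ K ++ copies js Hs) + ⟦ β ⟧ + β⋆
        ≡⟨ cong (_+ β⋆) (rk-replace j _ (All.++⁺ (av j) (copies-avoid j≢ Hs)) H) ⟩
      rk H + rk (ℓ ++ K ++ copies js Hs) + β⋆                     ≡⟨ +-assoc (rk H) _ _ ⟩
      rk H + (rk (ℓ ++ K ++ copies js Hs) + β⋆)                   ≡⟨ cong (λ es → rk H + (rk es + β⋆)) (++-assoc ℓ K _) ⟨
      rk H + (rk ((ℓ ++ K) ++ copies js Hs) + β⋆)
        ≡⟨ cong (rk H +_) (rk-copies js! (λ i → All.++⁺ (link-avoids β j i) (av i)) Hs) ⟩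
      rk H + (sum rk Hs + rk ((ℓ ++ K) ++ s))                     ≡⟨ +-assoc (rk H) _ _ ⟨
      rk H + sum rk Hs + rk ((ℓ ++ K) ++ s)
        ≡⟨ cong (λ es → rk H + sum rk Hs + rk es) (++-assoc ℓ K s) ⟩
      rk H + sum rk Hs + rk (ℓ ++ K ++ s)                         ≡⟨ cong (rk H + sum rk Hs +_) (rk-↭ (shifts ℓ K)) ⟩
      rk H + sum rk Hs + rk (K ++ ℓ ++ s)                         ∎
      where
      open ≡-Reasoning
      β  = joined H
      β⋆ = sum (⟦_⟧ ∘ joined) Hs
      ℓ  = link β (glue j X) (glue j Y)
      s  = skeleton js (Vec.map joined Hs)

    -- The companion of `rk-copies` for edge counts, so that ranks and sizes pass to the skeleton
    -- with the same correction.
    length-copies : ∀ (js : Vec (Fin 4) k) (K : Edges (4 + 4 * m)) Hs →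
                    length (K ++ copies js Hs) + sum (⟦_⟧ ∘ joined) Hs ≡
                    sum length Hs + length (K ++ skeleton js (Vec.map joined Hs))
    length-copies js K Hs = begin
      length (K ++ copies js Hs) + β⋆ Hs            ≡⟨ cong (_+ β⋆ Hs) (length-++ K) ⟩
      length K + length (copies js Hs) + β⋆ Hs      ≡⟨ +-assoc (length K) _ _ ⟩
      length K + (length (copies js Hs) + β⋆ Hs)    ≡⟨ cong (length K +_) (go js Hs) ⟩
      length K + (sum length Hs + length (s js Hs))
        ≡⟨ solve 3 (λ x y z → x :+ (y :+ z) := y :+ (x :+ z)) refl (length K) (sum length Hs) (length (s js Hs)) ⟩
      sum length Hs + (length K + length (s js Hs)) ≡⟨ cong (sum length Hs +_) (length-++ K) ⟨
      sum length Hs + length (K ++ s js Hs)         ∎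
      where
      open ≡-Reasoning
      β⋆ : Vec (Edges (2 + m)) k → ℕ
      β⋆ = sum (⟦_⟧ ∘ joined)
      s : Vec (Fin 4) k → Vec (Edges (2 + m)) k → Edges (4 + 4 * m)
      s js Hs = skeleton js (Vec.map joined Hs)
      length-link : ∀ β (u v : Fin (4 + 4 * m)) → length (link β u v) ≡ ⟦ β ⟧
      length-link true  u v = refl
      length-link false u v = refl
      go : ∀ {k} (js : Vec (Fin 4) k) Hs → length (copies js Hs) + β⋆ Hs ≡ sum length Hs + length (s js Hs)
      go [] [] = refl
      go (j ∷ js) (H ∷ Hs)
        rewrite length-++ (image (glue j) H) {copies js Hs} | length-map (Product.map (glue j) (glue j)) H
              | length-++ (link (joined H) (glue j X) (glue j Y)) {s js Hs}
              | length-link (joined H) (glue j X) (glue j Y) = begin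
        length H + length (copies js Hs) + (⟦ joined H ⟧ + β⋆ Hs)
          ≡⟨ solve 4 (λ x y z w → x :+ y :+ (z :+ w) := x :+ (z :+ (y :+ w)))
               refl (length H) (length (copies js Hs)) ⟦ joined H ⟧ (β⋆ Hs) ⟩
        length H + (⟦ joined H ⟧ + (length (copies js Hs) + β⋆ Hs))
          ≡⟨ cong (λ x → length H + (⟦ joined H ⟧ + x)) (go js Hs) ⟩
        length H + (⟦ joined H ⟧ + (sum length Hs + length (s js Hs)))
          ≡⟨ solve 4 (λ x z y w → x :+ (z :+ (y :+ w)) := x :+ y :+ (z :+ w))
               refl (length H) ⟦ joined H ⟧ (sum length Hs) (length (s js Hs)) ⟩
        length H + sum length Hs + (⟦ joined H ⟧ + length (s js Hs))      ∎

  -- Exponents attached to spanning subgraphs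

  ∈-sublists⇒⊆ : ∀ {A : Set} {xs ys : List A} → xs ∈ sublists ys → xs ⊆ ys
  ∈-sublists⇒⊆ {ys = []} (here refl) = []
  ∈-sublists⇒⊆ {ys = y ∷ ys} p with ∈-++⁻ (sublists ys) p
  ... | inj₁ q = y ∷ʳ ∈-sublists⇒⊆ q
  ... | inj₂ q with _ , r , refl ← ∈-map⁻ (y ∷_) q = refl ∷ ∈-sublists⇒⊆ r

  XY : Fin (2 + m) × Fin (2 + m)
  XY = X , Y

  -- For joined E and H ⊆ E this is rk E − rk H + (length H − rk H), less one if
  -- H does not join X to Y; a single truncated subtraction, exact by weight-balance.
  weight : Edges (2 + m) → Edges (2 + m) → ℕ
  weight E H = (rk E + length H) ∸ (rk (XY ∷ H) + rk H)

  module _ {E : Edges (2 + m)} (joinedE : joined E ≡ true) where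

    -- No truncation occurs: `rk (XY ∷ H)` is at most `rk (XY ∷ E)`, which is `rk E` because `E`
    -- already joins the terminals, and `rk H` is at most `length H`.
    weight-balance : ∀ {H} → H ⊆ E → weight E H + (rk (XY ∷ H) + rk H) ≡ rk E + length H
    weight-balance {H} H⊆E = m∸n+n≡m (+-mono-≤ bound (rk≤length H))
      where
      bound : rk (XY ∷ H) ≤ rk E
      bound = ≤-trans (rk-mono (lookup (refl ∷ H⊆E))) (≤-reflexive (cong (λ β → ⟦ not β ⟧ + rk E) joinedE))

    -- The left side is the exponent of z in the Tutte sum when both variables are equal. Adding
    -- `rk H` twice clears every subtraction and leaves `weight-balance`.
    rank-nullity-weight : ∀ {H} → H ⊆ E →
                          (rk E ∸ rk H) + (length H ∸ rk H) ≡ ⟦ not (joined H) ⟧ + weight E H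
    rank-nullity-weight {H} H⊆E = +-cancelʳ-≡ (rk H + rk H) _ _ (begin
      (rk E ∸ rk H) + (length H ∸ rk H) + (rk H + rk H)
        ≡⟨ solve 3 (λ x y h → x :+ y :+ (h :+ h) := (x :+ h) :+ (y :+ h)) refl (rk E ∸ rk H) (length H ∸ rk H) (rk H) ⟩
      (rk E ∸ rk H) + rk H + (length H ∸ rk H + rk H)
        ≡⟨ cong₂ _+_ (m∸n+n≡m (rk-mono (lookup H⊆E))) (m∸n+n≡m (rk≤length H)) ⟩
      rk E + length H                                           ≡⟨ weight-balance H⊆E ⟨
      weight E H + (⟦ not (joined H) ⟧ + rk H + rk H)
        ≡⟨ solve 3 (λ w β h → w :+ (β :+ h :+ h) := β :+ w :+ (h :+ h)) refl (weight E H) ⟦ not (joined H) ⟧ (rk H) ⟩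
      ⟦ not (joined H) ⟧ + weight E H + (rk H + rk H)           ∎)
      where open ≡-Reasoning

    weights-balance : ∀ {Hs : Vec (Edges (2 + m)) k} → VecAll.All (_⊆ E) Hs →
                      sum (weight E) Hs + (sum (⟦_⟧ ∘ not ∘ joined) Hs + (sum rk Hs + sum rk Hs)) ≡
                      k * rk E + sum length Hs
    weights-balance [] = refl
    weights-balance {k = suc k} {H ∷ Hs} (H⊆E ∷ Hs⊆E) = begin
      w + ws + (β + βs + (h + hs + (h + hs)))
        ≡⟨ solve 6 (λ w ws β βs h hs →
             w :+ ws :+ (β :+ βs :+ (h :+ hs :+ (h :+ hs))) := w :+ (β :+ h :+ h) :+ (ws :+ (βs :+ (hs :+ hs))))
             refl w ws β βs h hs ⟩
      w + (β + h + h) + (ws + (βs + (hs + hs)))     ≡⟨ cong₂ _+_ (weight-balance H⊆E) (weights-balance Hs⊆E) ⟩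
      rk E + length H + (k * rk E + sum length Hs)
        ≡⟨ solve 4 (λ x y z u → x :+ y :+ (z :+ u) := x :+ z :+ (y :+ u))
             refl (rk E) (length H) (k * rk E) (sum length Hs) ⟩
      rk E + k * rk E + (length H + sum length Hs)  ∎
      where
      open ≡-Reasoning
      w = weight E H ; ws = sum (weight E) Hs
      β = ⟦ not (joined H) ⟧ ; βs = sum (⟦_⟧ ∘ not ∘ joined) Hs
      h = rk H ; hs = sum rk Hs

  joined+notJoined : ∀ (Hs : Vec (Edges (2 + m)) k) → sum (⟦_⟧ ∘ joined) Hs + sum (⟦_⟧ ∘ not ∘ joined) Hs ≡ k
  joined+notJoined [] = refl
  joined+notJoined (H ∷ Hs) with joined H
  ... | true  = cong suc (joined+notJoined Hs)
  ... | false = trans (+-suc _ _) (cong suc (joined+notJoined Hs))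

  ⟦not⟧-injective : ∀ {β γ} → ⟦ not β ⟧ ≡ ⟦ not γ ⟧ → β ≡ γ
  ⟦not⟧-injective {true}  {true}  _ = refl
  ⟦not⟧-injective {false} {false} _ = refl

  -- The bridge network and its states

  quarters : Vec (Fin 4) 4
  quarters = 0F ∷ 1F ∷ 2F ∷ 3F ∷ []

  quarters-unique : VecPairs.AllPairs _≢_ quarters
  quarters-unique = ((λ ()) ∷ (λ ()) ∷ (λ ()) ∷ []) ∷ ((λ ()) ∷ (λ ()) ∷ []) ∷ ((λ ()) ∷ []) ∷ [] ∷ []

  module Bridge (m : ℕ) where
    open Copies m

    diagonal : Bool → Edges (4 + 4 * m)
    diagonal β = link β a b

    bridge : Bool → Vec Bool 4 → Edges (4 + 4 * m)
    bridge β βs = diagonal β ++ skeleton quarters βs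

    -- `G-edges (suc n)` is by definition `assemble true (replicate 4 (G-edges n))`, so results on
    -- assemblies apply to it directly.
    assemble : Bool → Vec (Edges (2 + m)) 4 → Edges (4 + 4 * m)
    assemble β Hs = diagonal β ++ copies quarters Hs

    fullBridge : Edges (4 + 4 * m)
    fullBridge = bridge true (replicate 4 true)

    diagonal-avoids : ∀ β j → Avoids j (diagonal β)
    diagonal-avoids true  j = ((λ w ()) , (λ w ())) ∷ []
    diagonal-avoids false j = []

    XY-avoids : ∀ β j → Avoids j (XY ∷ diagonal β)
    XY-avoids β j = ((λ w ()) , (λ w ())) ∷ diagonal-avoids β j

    link⊆ : ∀ β (u v : Fin (4 + 4 * m)) → link β u v ⊆ link true u v
    link⊆ true  u v = ⊆-refl
    link⊆ false u v = (u , v) ∷ʳ []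

    skeleton⊆ : ∀ (js : Vec (Fin 4) k) βs → skeleton js βs ⊆ skeleton js (replicate k true)
    skeleton⊆ []       []       = []
    skeleton⊆ (j ∷ js) (β ∷ βs) = ++⁺ (link⊆ β _ _) (skeleton⊆ js βs)

    bridge⊆ : ∀ β βs → bridge β βs ⊆ fullBridge
    bridge⊆ β βs = ++⁺ (link⊆ β a b) (skeleton⊆ quarters βs)

    rk-assemble : ∀ β Hs → rk (assemble β Hs) + sum (⟦_⟧ ∘ joined) Hs ≡
                           sum rk Hs + rk (bridge β (Vec.map joined Hs))
    rk-assemble β = rk-copies quarters-unique (diagonal-avoids β)

    rk-XY-assemble : ∀ β Hs → rk (XY ∷ assemble β Hs) + sum (⟦_⟧ ∘ joined) Hs ≡
                              sum rk Hs + rk (XY ∷ bridge β (Vec.map joined Hs))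
    rk-XY-assemble β = rk-copies quarters-unique (XY-avoids β)

    -- Being joined can be read off from ranks: it decides whether prepending `XY` raises the rank.
    -- Both ranks pass to the bridge by `rk-copies`, so no separate argument about paths is needed.
    joined-assemble : ∀ β Hs → joined (assemble β Hs) ≡ joined (bridge β (Vec.map joined Hs))
    joined-assemble β Hs = ⟦not⟧-injective (+-cancelʳ-≡ (sum rk Hs + rk S) _ _ (begin
      ⟦ not (joined H) ⟧ + (sum rk Hs + rk S)  ≡⟨ cong (⟦ not (joined H) ⟧ +_) (rk-assemble β Hs) ⟨
      ⟦ not (joined H) ⟧ + (rk H + βs)         ≡⟨ +-assoc ⟦ not (joined H) ⟧ (rk H) βs ⟨
      rk (XY ∷ H) + βs                         ≡⟨ rk-XY-assemble β Hs ⟩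
      sum rk Hs + rk (XY ∷ S)
        ≡⟨ solve 3 (λ x y z → x :+ (y :+ z) := y :+ (x :+ z)) refl (sum rk Hs) ⟦ not (joined S) ⟧ (rk S) ⟩
      ⟦ not (joined S) ⟧ + (sum rk Hs + rk S)  ∎))
      where
      open ≡-Reasoning
      βs = sum (⟦_⟧ ∘ joined) Hs
      H = assemble β Hs
      S = bridge β (Vec.map joined Hs)

    module _ {E : Edges (2 + m)} (joinedE : joined E ≡ true) where
      private
        E′ : Edges (4 + 4 * m)
        E′ = assemble true (replicate 4 E)

      joined-whole : joined E′ ≡ true
      joined-whole = trans (joined-assemble true (replicate 4 E)) states
        where
        states : joined (bridge true (Vec.map joined (replicate 4 E))) ≡ true
        states rewrite joinedE = refl

      -- Each of the four copies is joined, which gives the 4; the resulting full bridge connects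
      -- the four vertices `X`, `Y`, `a`, `b`, which gives rank 3.
      rk-whole : rk E′ + 4 ≡ 4 * rk E + 3
      rk-whole = trans (cong (rk E′ +_) (sym four)) (trans (rk-assemble true (replicate 4 E)) (cong (4 * rk E +_) three))
        where
        four : sum (⟦_⟧ ∘ joined) (replicate 4 E) ≡ 4
        four rewrite joinedE = refl
        three : rk (bridge true (Vec.map joined (replicate 4 E))) ≡ 3
        three rewrite joinedE = refl

      -- This additivity lets the sum over subgraphs factor into four sums over copies and one over
      -- bridge states.
      weight-assemble : ∀ β {Hs} → VecAll.All (_⊆ E) Hs →
        weight E′ (assemble β Hs) ≡ sum (weight E) Hs + weight fullBridge (bridge β (Vec.map joined Hs))
      weight-assemble β {Hs} Hs⊆E =
        trans (cong (_∸ (R′ + r′)) (sym balance)) (m+n∸n≡m (ws + x) (R′ + r′))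
        where
        H = assemble β Hs
        S = bridge β (Vec.map joined Hs)
        R′ = rk (XY ∷ H) ; r′ = rk H ; l′ = length H ; ρ′ = rk E′
        RS = rk (XY ∷ S) ; rS = rk S ; lS = length S
        ws = sum (weight E) Hs ; x = weight fullBridge S
        B = sum (⟦_⟧ ∘ joined) Hs ; N = sum (⟦_⟧ ∘ not ∘ joined) Hs
        r = sum rk Hs ; l = sum length Hs ; ρ = rk E
        open ≡-Reasoning
        balance : ws + x + (R′ + r′) ≡ ρ′ + l′
        -- One `B` is absorbed by each of the two rank identities, and `N` by `weights-balance`. At
        -- the other end `B + N`, the number of copies, matches the 4 of `rk-whole`, and the
        -- remaining `B` serves `length-copies`.
        balance = +-cancelʳ-≡ (B + (B + N)) _ _ (begin
          ws + x + (R′ + r′) + (B + (B + N))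
            ≡⟨ solve 6 (λ ws x R′ r′ B N →
                 ws :+ x :+ (R′ :+ r′) :+ (B :+ (B :+ N)) := ws :+ x :+ N :+ ((R′ :+ B) :+ (r′ :+ B)))
                   refl ws x R′ r′ B N ⟩
          ws + x + N + ((R′ + B) + (r′ + B))
            ≡⟨ cong (ws + x + N +_) (cong₂ _+_ (rk-XY-assemble β Hs) (rk-assemble β Hs)) ⟩
          ws + x + N + ((r + RS) + (r + rS))
            ≡⟨ solve 6 (λ ws x N r RS rS →
                 ws :+ x :+ N :+ ((r :+ RS) :+ (r :+ rS)) := ws :+ (N :+ (r :+ r)) :+ (x :+ (RS :+ rS)))
                   refl ws x N r RS rS ⟩
          ws + (N + (r + r)) + (x + (RS + rS))
            ≡⟨ cong₂ _+_ (weights-balance joinedE Hs⊆E) (weight-balance {E = fullBridge} refl (bridge⊆ β (Vec.map joined Hs))) ⟩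
          4 * ρ + l + (3 + lS)
            ≡⟨ solve 3 (λ ρ l lS → ρ :+ l :+ (con 3 :+ lS) := (ρ :+ con 3) :+ (l :+ lS)) refl (4 * ρ) l lS ⟩
          4 * ρ + 3 + (l + lS)
            ≡⟨ cong₂ _+_ rk-whole (length-copies quarters (diagonal β) Hs) ⟨
          ρ′ + 4 + (l′ + B)
            ≡⟨ cong (λ n → ρ′ + n + (l′ + B)) (joined+notJoined Hs) ⟨
          ρ′ + (B + N) + (l′ + B)
            ≡⟨ solve 4 (λ ρ′ l′ B N → ρ′ :+ (B :+ N) :+ (l′ :+ B) := ρ′ :+ l′ :+ (B :+ (B :+ N))) refl ρ′ l′ B N ⟩
          ρ′ + l′ + (B + (B + N)) ∎)

open BridgeNetwork

-- Closed form of the exponent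

exponent : ℕ → ℕ
exponent zero    = 0
exponent (suc n) = suc (exponent n ℕ.* 4)

-- The recursion mirrors the passage from A to A⁴ times one more factor. By induction 4 ^ n is one
-- more than three times the exponent, so the division is exact.
exponent-closed : ∀ n → (4 ℕ.^ n ∸ 1) / 3 ≡ exponent n
exponent-closed n = ≡.trans (≡.cong (λ p → (p ∸ 1) / 3) (power n)) (m*n/n≡m (exponent n) 3)
  where
  power : ∀ n → 4 ℕ.^ n ≡ suc (exponent n ℕ.* 3)
  power zero    = ≡.refl
  power (suc n) = ≡.trans (≡.cong (4 ℕ.*_) (power n))
    (solve 1 (λ e → con 4 :* (con 1 :+ e :* con 3) := con 1 :+ (con 1 :+ e :* con 4) :* con 3) ≡.refl (exponent n))
    where open +-*-Solver

-- The operation is a parameter so that one fold serves both for sums in the ring and for the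
-- solver's polynomial expressions.
foldBools : ∀ {ℓ} {A : Set ℓ} → (A → A → A) → ∀ k → (Vec Bool k → A) → A
foldBools _⊕_ zero    F = F []
foldBools _⊕_ (suc k) F = foldBools _⊕_ k (F ∘ (true ∷_)) ⊕ foldBools _⊕_ k (F ∘ (false ∷_))

joined-G : ∀ n → joined (G-edges n) ≡ true
joined-G zero    = ≡.refl
joined-G (suc n) = Bridge.joined-whole (nonSpecial n) {G-edges n} (joined-G n)

-- Sums over sublists in a commutative ring

module _ {c ℓ} (R : CommutativeRing c ℓ) where
  open CommutativeRing R
  open Exponentiation semiring using (_^_; ^-homo-*; ^-assocʳ)
  open Multiples semiring using (_×_)
  open RingSolver commutativeSemiring using (solve; _:=_; _:+_; _:*_; _:^_; _:×_; con)
  open import Relation.Binary.Reasoning.Setoid setoid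

  ∑ : ∀ {A : Set} → List A → (A → Carrier) → Carrier
  ∑ xs f = foldr _+_ 0# (map f xs)

  module _ {A : Set} where

    ∑-cong : ∀ {f g : A → Carrier} xs → (∀ {x} → x ∈ xs → f x ≈ g x) → ∑ xs f ≈ ∑ xs g
    ∑-cong []       h = refl
    ∑-cong (x ∷ xs) h = +-cong (h (here ≡.refl)) (∑-cong xs (h ∘ there))

    ∑-++ : ∀ (xs ys : List A) f → ∑ (xs ++ ys) f ≈ ∑ xs f + ∑ ys f
    ∑-++ []       ys f = sym (+-identityˡ _)
    ∑-++ (x ∷ xs) ys f = trans (+-congˡ (∑-++ xs ys f)) (sym (+-assoc _ _ _))

    ∑-map : ∀ {B : Set} (h : B → A) xs f → ∑ (map h xs) f ≈ ∑ xs (f ∘ h)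
    ∑-map h []       f = refl
    ∑-map h (x ∷ xs) f = +-congˡ (∑-map h xs f)

  ∑-sublists-∷ : ∀ {A : Set} (x : A) xs f → ∑ (sublists (x ∷ xs)) f ≈ ∑ (sublists xs) f + ∑ (sublists xs) (f ∘ (x ∷_))
  ∑-sublists-∷ x xs f = trans (∑-++ (sublists xs) _ f) (+-congˡ (∑-map (x ∷_) (sublists xs) f))

  ∑-sublists-map : ∀ {A B : Set} (h : B → A) xs f → ∑ (sublists (map h xs)) f ≈ ∑ (sublists xs) (f ∘ map h)
  ∑-sublists-map h []       f = refl
  ∑-sublists-map h (x ∷ xs) f = begin
    ∑ (sublists (h x ∷ map h xs)) f                                            ≈⟨ ∑-sublists-∷ (h x) (map h xs) f ⟩
    ∑ (sublists (map h xs)) f + ∑ (sublists (map h xs)) (f ∘ (h x ∷_))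
      ≈⟨ +-cong (∑-sublists-map h xs f) (∑-sublists-map h xs (f ∘ (h x ∷_))) ⟩
    ∑ (sublists xs) (f ∘ map h) + ∑ (sublists xs) (f ∘ (h x ∷_) ∘ map h)       ≈⟨ ∑-sublists-∷ x xs (f ∘ map h) ⟨
    ∑ (sublists (x ∷ xs)) (f ∘ map h)                                          ∎

  ∑-sublists-++ : ∀ {A : Set} (xs ys : List A) f →
                  ∑ (sublists (xs ++ ys)) f ≈ ∑ (sublists xs) λ zs → ∑ (sublists ys) (f ∘ (zs ++_))
  ∑-sublists-++ []       ys f = sym (+-identityʳ _)
  ∑-sublists-++ (x ∷ xs) ys f = begin
    ∑ (sublists (x ∷ xs ++ ys)) f                                          ≈⟨ ∑-sublists-∷ x (xs ++ ys) f ⟩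
    ∑ (sublists (xs ++ ys)) f + ∑ (sublists (xs ++ ys)) (f ∘ (x ∷_))
      ≈⟨ +-cong (∑-sublists-++ xs ys f) (∑-sublists-++ xs ys (f ∘ (x ∷_))) ⟩
    ∑ (sublists xs) g + ∑ (sublists xs) (g ∘ (x ∷_))                       ≈⟨ ∑-sublists-∷ x xs g ⟨
    ∑ (sublists (x ∷ xs)) g                                                ∎
    where
    g : List _ → Carrier
    g zs = ∑ (sublists ys) (f ∘ (zs ++_))

  ∑Bools : ∀ k → (Vec Bool k → Carrier) → Carrier
  ∑Bools = foldBools _+_

  ∑Bools-*ˡ : ∀ k t F → ∑Bools k (λ βs → t * F βs) ≈ t * ∑Bools k F
  ∑Bools-*ˡ zero    t F = refl
  ∑Bools-*ˡ (suc k) t F = trans (+-cong (∑Bools-*ˡ k t _) (∑Bools-*ˡ k t _)) (sym (distribˡ t _ _))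

  -- Balanced weighted sums

  module _ (z : Carrier) where

    weightedSum : ∀ {m} → Edges (2 ℕ.+ m) → (Bool → Carrier) → Carrier
    weightedSum E f = ∑ (sublists E) λ H → z ^ weight E H * f (joined H)

    -- Taking indicator functions for `f` shows that the joined and the separated subgraphs both
    -- have total weight `A`. Quantifying over `f` lets the rest of the bridge be inserted as a test
    -- function.
    Balanced : ∀ {m} → Edges (2 ℕ.+ m) → Carrier → Set _
    Balanced E A = ∀ f → weightedSum E f ≈ A * (f true + f false)

    module _ (m : ℕ) where
      open Copies m
      open Bridge m

      bridgeTerm : (Bool → Carrier) → Bool → Vec Bool 4 → Carrier
      bridgeTerm f β βs = z ^ weight fullBridge (bridge β βs) * f (joined (bridge β βs))

      -- That f true and f false get the same factor is the self-duality of the bridge.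
      ∑-bridge : ∀ f → ∑Bools 4 (bridgeTerm f false) + ∑Bools 4 (bridgeTerm f true) ≈
                       (z ^ 2 + 7 × z + 8 × 1#) * (f true + f false)
      ∑-bridge f = solve 3 (λ z p q →
          -- The bridge touches only the four named vertices, so its weights and connections
          -- evaluate to constants even for a variable `m`. The solver thus sees 32 explicit
          -- monomials.
          let term = λ β βs → z :^ weight fullBridge (bridge β βs) :* (if joined (bridge β βs) then p else q)
          in foldBools _:+_ 4 (term false) :+ foldBools _:+_ 4 (term true) :=
             (z :^ 2 :+ 7 :× z :+ 8 :× con 1) :* (p :+ q))
        refl z (f true) (f false)

      module _ {E : Edges (2 ℕ.+ m)} {A} (balanced : Balanced E A) where

        -- Each balanced copy contributes a factor `A` and leaves only its joined or separated state
        -- to be summed. The function `g` is arbitrary so that the induction can fix the choice made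
        -- in the first copy.
        ∑-copies : ∀ {k} (js : Vec (Fin 4) k) (g : Edges (4 ℕ.+ 4 ℕ.* m) → Carrier) (F : Vec Bool k → Carrier) →
                   (∀ {Hs} → VecAll.All (_⊆ E) Hs → g (copies js Hs) ≈ z ^ sum (weight E) Hs * F (Vec.map joined Hs)) →
                   ∑ (sublists (copies js (replicate k E))) g ≈ A ^ k * ∑Bools k F
        ∑-copies [] g F h = trans (+-identityʳ _) (h [])
        ∑-copies {suc k} (j ∷ js) g F h = begin
          ∑ (sublists (image (glue j) E ++ C)) g
            ≈⟨ ∑-sublists-++ (image (glue j) E) C g ⟩
          ∑ (sublists (image (glue j) E)) (λ H → ∑ (sublists C) (g ∘ (H ++_)))
            ≈⟨ ∑-sublists-map _ E _ ⟩
          ∑ (sublists E) (λ H → ∑ (sublists C) (g ∘ (image (glue j) H ++_)))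
            ≈⟨ ∑-cong (sublists E) (λ H∈ → inner (∈-sublists⇒⊆ H∈)) ⟩
          weightedSum E (λ β → A ^ k * Φ β)
            -- The test function is the contribution of the remaining copies, which depends on the
            -- first one only through its state.
            ≈⟨ balanced (λ β → A ^ k * Φ β) ⟩
          A * (A ^ k * Φ true + A ^ k * Φ false)
            ≈⟨ solve 4 (λ A B p q → A :* (B :* p :+ B :* q) := A :* B :* (p :+ q)) refl A (A ^ k) (Φ true) (Φ false) ⟩
          A * A ^ k * (Φ true + Φ false) ∎
          where
          C = copies js (replicate k E)
          Φ : Bool → Carrier
          Φ β = ∑Bools k (F ∘ (β ∷_))
          inner : ∀ {H} → H ⊆ E →
                  ∑ (sublists C) (g ∘ (image (glue j) H ++_)) ≈ z ^ weight E H * (A ^ k * Φ (joined H))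
          inner {H} H⊆E = begin
            ∑ (sublists C) (g ∘ (image (glue j) H ++_))
              -- The power of `z` from the chosen `H` is stored in the state function for the
              -- induction, then pulled out by `∑Bools-*ˡ`.
              ≈⟨ ∑-copies js _ (λ βs → z ^ weight E H * F (joined H ∷ βs)) (λ {Hs} Hs⊆E →
                   trans (h (H⊆E ∷ Hs⊆E)) (trans (*-congʳ (^-homo-* z (weight E H) _))
                     (solve 3 (λ u v w → u :* v :* w := v :* (u :* w)) refl (z ^ weight E H) (z ^ sum (weight E) Hs) _))) ⟩
            A ^ k * ∑Bools k (λ βs → z ^ weight E H * F (joined H ∷ βs))
              ≈⟨ *-congˡ (∑Bools-*ˡ k (z ^ weight E H) (F ∘ (joined H ∷_))) ⟩
            A ^ k * (z ^ weight E H * Φ (joined H))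
              ≈⟨ solve 3 (λ u v w → u :* (v :* w) := v :* (u :* w)) refl (A ^ k) (z ^ weight E H) (Φ (joined H)) ⟩
            z ^ weight E H * (A ^ k * Φ (joined H)) ∎

        -- Subgraphs are split by absence or presence of the diagonal. `∑-copies` turns each half
        -- into `A ^ 4` times a sum over 16 bridge states, and `∑-bridge` adds the two.
        balanced-assemble : joined E ≡ true →
                            Balanced (assemble true (replicate 4 E)) (A ^ 4 * (z ^ 2 + 7 × z + 8 × 1#))
        balanced-assemble joinedE f = begin
          ∑ (sublists E′) h
            ≈⟨ ∑-sublists-∷ (a , b) C h ⟩
          ∑ (sublists C) h + ∑ (sublists C) (h ∘ ((a , b) ∷_))
            ≈⟨ +-cong (∑-copies quarters h (bridgeTerm f false) (factor false))
                      (∑-copies quarters (h ∘ ((a , b) ∷_)) (bridgeTerm f true) (factor true)) ⟩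
          A ^ 4 * ∑Bools 4 (bridgeTerm f false) + A ^ 4 * ∑Bools 4 (bridgeTerm f true)
            ≈⟨ distribˡ (A ^ 4) _ _ ⟨
          A ^ 4 * (∑Bools 4 (bridgeTerm f false) + ∑Bools 4 (bridgeTerm f true))
            ≈⟨ *-congˡ (∑-bridge f) ⟩
          A ^ 4 * ((z ^ 2 + 7 × z + 8 × 1#) * (f true + f false))
            ≈⟨ *-assoc _ _ _ ⟨
          A ^ 4 * (z ^ 2 + 7 × z + 8 × 1#) * (f true + f false) ∎
          where
          C = copies quarters (replicate 4 E)
          E′ = assemble true (replicate 4 E)
          h : Edges (4 ℕ.+ 4 ℕ.* m) → Carrier
          h H = z ^ weight E′ H * f (joined H)
          factor : ∀ β {Hs} → VecAll.All (_⊆ E) Hs →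
                   h (assemble β Hs) ≈ z ^ sum (weight E) Hs * bridgeTerm f β (Vec.map joined Hs)
          factor β {Hs} Hs⊆E = begin
            z ^ weight E′ (assemble β Hs) * f (joined (assemble β Hs))
              ≡⟨ ≡.cong₂ (λ w γ → z ^ w * f γ) (weight-assemble joinedE β Hs⊆E) (joined-assemble β Hs) ⟩
            z ^ (sum (weight E) Hs ℕ.+ weight fullBridge S) * f (joined S)
              ≈⟨ *-congʳ (^-homo-* z (sum (weight E) Hs) _) ⟩
            z ^ sum (weight E) Hs * z ^ weight fullBridge S * f (joined S)
              ≈⟨ *-assoc _ _ _ ⟩
            z ^ sum (weight E) Hs * (z ^ weight fullBridge S * f (joined S)) ∎
            where S = bridge β (Vec.map joined Hs)

    balanced-G : ∀ n → Balanced (G-edges n) ((z ^ 2 + 7 × z + 8 × 1#) ^ exponent n)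
    -- In a single edge both the empty and the full subgraph have weight 0; the first separates the
    -- terminals and the second joins them.
    balanced-G zero f = solve 2 (λ p q → con 1 :* q :+ (con 1 :* p :+ con 0) := con 1 :* (p :+ q)) refl (f true) (f false)
    balanced-G (suc n) f = trans (balanced-assemble (nonSpecial n) {G-edges n} (balanced-G n) (joined-G n) f)
      (*-congʳ (trans (*-comm _ _) (*-congˡ (^-assocʳ _ (exponent n) 4))))

    -- By `rank-nullity-weight` the Tutte exponent exceeds `weight` by one exactly for subgraphs
    -- that separate the terminals, hence the value `z` there.
    tutte≈weightedSum : ∀ {m} (E : Edges (2 ℕ.+ m)) → joined E ≡ true → ∀ {x} → z ≡ x - 1# →
                        tutte R (graph (2 ℕ.+ m) E) x x ≈ weightedSum E (λ β → if β then 1# else z)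
    tutte≈weightedSum E joinedE ≡.refl =
      trans (∑-map (graph _) (sublists E) _) (∑-cong (sublists E) (λ H∈ → term (∈-sublists⇒⊆ H∈)))
      where
      power : ∀ β n → z ^ (⟦ not β ⟧ ℕ.+ n) ≈ z ^ n * (if β then 1# else z)
      power true  n = sym (*-identityʳ _)
      power false n = *-comm _ _
      term : ∀ {H} → H ⊆ E →
             z ^ (rank (graph _ E) ∸ rank (graph _ H)) * z ^ nullity (graph _ H) ≈ z ^ weight E H * (if joined H then 1# else z)
      term {H} H⊆E rewrite rank≡rk E | rank≡rk H | nullity≡ H = begin
        z ^ (rk E ∸ rk H) * z ^ (length H ∸ rk H)       ≈⟨ ^-homo-* z (rk E ∸ rk H) _ ⟨
        z ^ (rk E ∸ rk H ℕ.+ (length H ∸ rk H))         ≡⟨ ≡.cong (z ^_) (rank-nullity-weight joinedE H⊆E) ⟩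
        z ^ (⟦ not (joined H) ⟧ ℕ.+ weight E H)         ≈⟨ power (joined H) (weight E H) ⟩
        z ^ weight E H * (if joined H then 1# else z)   ∎

theorem4 : ∀ {c ℓ} (R : CommutativeRing c ℓ) →
    let open CommutativeRing R
        open Exponentiation semiring using (_^_)
        open Multiples semiring using (_×_)
    in (n : ℕ) → 1 ℕ.≤ n → (x : Carrier) →
       tutte R (G n) x x ≈ x * (x ^ 2 + 5 × x + 2 × 1#) ^ ((4 ℕ.^ n ℕ.∸ 1) / 3)
theorem4 R n _ x = begin
  tutte R (G n) x x                                            ≈⟨ tutte≈weightedSum R z (G-edges n) (joined-G n) ≡.refl ⟩
  weightedSum R z (G-edges n) (λ β → if β then 1# else z)      ≈⟨ balanced-G R z n (λ β → if β then 1# else z) ⟩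
  (z ^ 2 + 7 × z + 8 × 1#) ^ exponent n * (1# + z)             ≈⟨ *-comm _ _ ⟩
  (1# + z) * (z ^ 2 + 7 × z + 8 × 1#) ^ exponent n             ≈⟨ *-cong 1+z≈x (^-congˡ (exponent n) shift) ⟩
  x * (x ^ 2 + 5 × x + 2 × 1#) ^ exponent n
    ≡⟨ ≡.cong (λ e → x * (x ^ 2 + 5 × x + 2 × 1#) ^ e) (exponent-closed n) ⟨
  x * (x ^ 2 + 5 × x + 2 × 1#) ^ ((4 ℕ.^ n ℕ.∸ 1) / 3)         ∎
  where
  open CommutativeRing R
  open Exponentiation semiring using (_^_; ^-congˡ)
  open Multiples semiring using (_×_; ×-congʳ)
  open RingSolver commutativeSemiring using (solve; _:=_; _:+_; _:*_; _:^_; _:×_; con)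
  open import Relation.Binary.Reasoning.Setoid setoid
  z = x - 1#
  1+z≈x : 1# + z ≈ x
  1+z≈x = trans (+-comm _ _) (trans (+-assoc _ _ _) (trans (+-congˡ (-‿inverseˡ 1#)) (+-identityʳ x)))
  shift : z ^ 2 + 7 × z + 8 × 1# ≈ x ^ 2 + 5 × x + 2 × 1#
  shift = trans
    -- Writing x as 1 + z, rather than z as x - 1, keeps the identity free of negation, so it holds
    -- over a commutative semiring.
    (solve 1 (λ z → z :^ 2 :+ 7 :× z :+ 8 :× con 1 := (con 1 :+ z) :^ 2 :+ 5 :× (con 1 :+ z) :+ 2 :× con 1) refl z)
    (+-congʳ (+-cong (^-congˡ 2 1+z≈x) (×-congʳ 5 1+z≈x)))
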